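{- Let $G=(V,E)$ be a connected graph, $G'=(V,E')$ a graph with $E\subseteq E'$, and $e\in E'$. Then the inequality $x_e\le1$ defines a facet of $\Xi_{GG'}$ if and only if there is no $\{v,w\}=f\in F_{GG'}$ such that $e$ connects a pair of $v$-$w$-cut-vertices.
   Context: All graphs are finite, simple and undirected; an edge $\{v,w\}$ is also written $vw$. Paths and cycles have no repeated nodes and are identified with their edge sets. For distinct $v,w\in V$, $vw\text{ -paths}(G)$ is the set of all paths in $G$ from $v$ to $w$; a $vw$-cut of $G$ is an inclusion-minimal set $C\subseteq E$ such that $v$ and $w$ are not connected in $(V,E\setminus C)$, and $vw\text{ -cuts}(G)$ is the set of all of these. For a connected graph $G=(V,E)$ and a graph $G'=(V,E')$ with $E\subseteq E'$, let $F_{GG'}:=E'\setminus E$ and let $X_{GG'}$ be the set of all $x\in\{0,1\}^{E'}$ such that (i) $x_e\le\sum_{e'\in C\setminus\{e\}}x_{e'}$ for every cycle $C$ of $G$ and every $e\in C$; (ii) $x_{vw}\le\sum_{e\in P}x_e$ for every $vw\in F_{GG'}$ and every $P\in vw\text{ -paths}(G)$; (iii) $1-x_{vw}\le\sum_{e\in C}(1-x_e)$ for every $vw\in F_{GG'}$ and every $C\in vw\text{ -cuts}(G)$. The lifted multicut polytope is $\Xi_{GG'}:=\operatorname{conv}X_{GG'}\subset\mathbb{R}^{E'}$. For any $v,w\in V$, a $v$-$w$-cut-vertex is a node $u\in V$ that lies on every $vw$-path of $G$.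
   Formalization: The edge f is required to differ from e: v and w are themselves v-w-cut-vertices, so allowing f = e would wrongly deny a facet for every e in F (for G the path a-b-c and F = {ac}, x_ac ≤ 1 does define a facet). -}

module Defs where

open import Level using (Level; _⊔_) renaming (suc to lsuc)
open import Algebra.Bundles using (CommutativeRing)
open import Data.Bool using (if_then_else_)
open import Data.Fin using (Fin; _<_; _≟_)
open import Data.Fin.Subset as Subset using (Subset; _∈_; _⊆_; _∪_; _─_; ∁; ⁅_⁆)
open import Data.List using (List; []; _∷_; length)
import Data.List.Membership.Propositional as List
open import Data.List.Relation.Unary.Unique.Propositional using (Unique)
open import Data.Nat using (ℕ; suc)
import Data.Nat as ℕ
open import Data.Product using (Σ; ∃; _×_; _,_)
open import Data.Sum using (_⊎_)
open import Data.Vec using (lookup)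
open import Data.Vec.Functional using (Vector)
open import Function using (_∘_)
open import Relation.Binary using (Rel; IsDecTotalOrder)
open import Relation.Binary.PropositionalEquality using (_≡_; _≢_)
open import Relation.Nullary using (¬_; does)
open import Relation.Unary using (Pred)
import Algebra.Definitions.RawMonoid as RawMonoidSum

------------------------------------------------------------------------
-- Scalars

-- Totally ordered fields.  Classically, ℝ is one of them; there is no ℝ
-- in the standard library, so everything is stated over all of them.

record OrderedField (c ℓ₁ ℓ₂ : Level) : Set (lsuc (c ⊔ ℓ₁ ⊔ ℓ₂)) where
  field
    commutativeRing : CommutativeRing c ℓ₁
  open CommutativeRing commutativeRing public
  infix 4 _≤_
  field
    _≤_             : Rel Carrier ℓ₂
    isDecTotalOrder : IsDecTotalOrder _≈_ _≤_
    1≉0             : ¬ (1# ≈ 0#)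
    inverse         : ∀ x → ¬ (x ≈ 0#) → ∃ λ y → x * y ≈ 1#
    +-monoʳ-≤       : ∀ x {y z} → y ≤ z → x + y ≤ x + z
    *-nonneg        : ∀ {x y} → 0# ≤ x → 0# ≤ y → 0# ≤ x * y

------------------------------------------------------------------------
-- Graphs

-- A simple graph on the node set Fin n whose m edges are numbered by
-- Fin m.  An edge {v , w} is stored with v < w, which excludes loops and
-- makes `simple` say that distinct edges are distinct node pairs.

record Graph (n m : ℕ) : Set where
  field
    src tgt : Fin m → Fin n
    src<tgt : ∀ e → src e < tgt e
    simple  : ∀ e f → src e ≡ src f → tgt e ≡ tgt f → e ≡ f

  Joins : Fin m → Fin n → Fin n → Set
  Joins e u v = (src e ≡ u × tgt e ≡ v) ⊎ (src e ≡ v × tgt e ≡ u)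

-- Throughout, G′ = (V , E′) is a `Graph`, and its subgraph G = (V , E) is
-- given by the subset E of the edges of G′; thus F_GG′ = E′ ∖ E is ∁ E.

module Subgraph {n m : ℕ} (G′ : Graph n m) where
  open Graph G′

  data Walk (E : Subset m) : Fin n → Fin n → Set where
    []   : ∀ {v} → Walk E v v
    step : ∀ {u v w} (e : Fin m) → e ∈ E → Joins e u v →
           Walk E v w → Walk E u w

  -- All nodes of a walk except the first one.
  laterNodes : ∀ {E u w} → Walk E u w → List (Fin n)
  laterNodes []                      = []
  laterNodes (step {v = v} _ _ _ ws) = v ∷ laterNodes ws

  nodes : ∀ {E u w} → Walk E u w → List (Fin n)
  nodes {u = u} ws = u ∷ laterNodes ws

  edges : ∀ {E u w} → Walk E u w → Subset m
  edges []               = Subset.⊥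
  edges (step e _ _ ws) = ⁅ e ⁆ ∪ edges ws

  Connected : Subset m → Set
  Connected E = ∀ v w → Walk E v w

  Path : Subset m → Fin n → Fin n → Set
  Path E v w = Σ (Walk E v w) λ p → Unique (nodes p)

  IsPath : Subset m → Fin n → Fin n → Subset m → Set
  IsPath E v w P = Σ (Path E v w) λ { (p , _) → edges p ≡ P }

  -- The list `laterNodes` of a closed walk mentions the start node once,
  -- at its end.
  IsCycle : Subset m → Subset m → Set
  IsCycle E C = ∃ λ v → Σ (Walk E v v) λ p →
    3 ℕ.≤ length (laterNodes p) × Unique (laterNodes p) × edges p ≡ C

  Separates : Subset m → Fin n → Fin n → Subset m → Set
  Separates E v w C = C ⊆ E × ¬ Walk (E ─ C) v w

  IsCut : Subset m → Fin n → Fin n → Subset m → Set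
  IsCut E v w C =
    Separates E v w C × (∀ D → D ⊆ C → Separates E v w D → D ≡ C)

  CutVertex : Subset m → Fin n → Fin n → Fin n → Set
  CutVertex E v w u = ∀ ((p , _) : Path E v w) → u List.∈ nodes p

  -- Both v and w are themselves v-w-cut-vertices.  Hence every e satisfies
  -- ConnectsCutVertices E e e, and a condition on the other edges has to
  -- require f ≢ e.  (For G the path a - b - c and F = {ac}, the inequality
  -- x_ac ≤ 1 does define a facet.)
  ConnectsCutVertices : Subset m → Fin m → Fin m → Set
  ConnectsCutVertices E e f =
    CutVertex E (src f) (tgt f) (src e) × CutVertex E (src f) (tgt f) (tgt e)

------------------------------------------------------------------------
-- Polytopes

module Polytope {c ℓ₁ ℓ₂} (K : OrderedField c ℓ₁ ℓ₂) where
  open OrderedField K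
  open RawMonoidSum +-rawMonoid using (sum) public

  Point : ℕ → Set c
  Point m = Vector Carrier m

  infix 7 _·_
  _·_ : ∀ {m} → Point m → Point m → Carrier
  a · x = sum λ i → a i * x i

  unit : ∀ {m} → Fin m → Point m
  unit e i = if does (i ≟ e) then 1# else 0#

  combination : ∀ {m k} → Vector Carrier k → Vector (Point m) k → Point m
  combination λs ps e = sum λ i → λs i * ps i e

  Conv : ∀ {m ℓ} → Pred (Point m) ℓ → Pred (Point m) (c ⊔ ℓ₁ ⊔ ℓ₂ ⊔ ℓ)
  Conv {m} X x =
    ∃ λ k → Σ (Vector Carrier k) λ λs → Σ (Vector (Point m) k) λ ps →
      (∀ i → X (ps i)) × (∀ i → 0# ≤ λs i) × sum λs ≈ 1# ×
      (∀ e → x e ≈ combination λs ps e)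

  AffinelyIndependent : ∀ {m k} → Vector (Point m) k → Set (c ⊔ ℓ₁)
  AffinelyIndependent {k = k} ps =
    ∀ (λs : Vector Carrier k) → sum λs ≈ 0# →
    (∀ e → combination λs ps e ≈ 0#) → ∀ i → λs i ≈ 0#

  HasDimension : ∀ {m ℓ} → Pred (Point m) ℓ → ℕ → Set (c ⊔ ℓ₁ ⊔ ℓ)
  HasDimension {m} S d =
    (Σ (Vector (Point m) (suc d)) λ ps →
       (∀ i → S (ps i)) × AffinelyIndependent ps) ×
    (∀ (ps : Vector (Point m) (suc (suc d))) →
       (∀ i → S (ps i)) → ¬ AffinelyIndependent ps)

  Valid : ∀ {m ℓ} → Pred (Point m) ℓ → Point m → Carrier → Set (c ⊔ ℓ₂ ⊔ ℓ)
  Valid S a b = ∀ x → S x → a · x ≤ b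

  Face : ∀ {m ℓ} → Pred (Point m) ℓ → Point m → Carrier →
         Pred (Point m) (ℓ₁ ⊔ ℓ)
  Face S a b x = S x × a · x ≈ b

  -- The inequality a · x ≤ b is valid for S, and its face has dimension
  -- dim S - 1.
  DefinesFacet : ∀ {m ℓ} → Pred (Point m) ℓ → Point m → Carrier →
                 Set (c ⊔ ℓ₁ ⊔ ℓ₂ ⊔ ℓ)
  DefinesFacet S a b =
    Valid S a b × ∃ λ d → HasDimension S (suc d) × HasDimension (Face S a b) d

------------------------------------------------------------------------
-- Lifted multicuts

module LiftedMulticut {c ℓ₁ ℓ₂} (K : OrderedField c ℓ₁ ℓ₂)
                      {n m : ℕ} (G′ : Graph n m) where
  open OrderedField K
  open Polytope K
  open Graph G′
  open Subgraph G′

  ∑[_] : Subset m → Point m → Carrier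
  ∑[ S ] y = sum λ e → if lookup S e then y e else 0#

  record X (E : Subset m) (x : Point m) : Set (c ⊔ ℓ₁ ⊔ ℓ₂) where
    field
      binary : ∀ e → x e ≈ 0# ⊎ x e ≈ 1#
      cycles : ∀ C → IsCycle E C → ∀ e → e ∈ C → x e ≤ ∑[ C Subset.- e ] x
      paths  : ∀ f → f ∈ ∁ E → ∀ P → IsPath E (src f) (tgt f) P →
               x f ≤ ∑[ P ] x
      cuts   : ∀ f → f ∈ ∁ E → ∀ C → IsCut E (src f) (tgt f) C →
               1# - x f ≤ ∑[ C ] (λ e → 1# - x e)

  Ξ : Subset m → Pred (Point m) (c ⊔ ℓ₁ ⊔ ℓ₂)
  Ξ E = Conv (X E)

{-# OPTIONS --safe #-}

-- A connected node set S of G gives the lifted multicut that vanishes exactly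
-- on the edges with both ends in S.
--
-- Suppose that e ≠ f ∈ F joins two cut-vertices of f.  If x_f = 0, then the
-- ends of f, hence those of e, are connected by edges of value 0, so x_e = 0.
-- The face x_e = 1 therefore lies in x_f = 1.  Adding to it a point with
-- x_e = 0 and x_f = 1 (from a walk between the ends of e missing an end of f)
-- and the origin raises the dimension by two.
--
-- Otherwise, every f ≠ e has a walk in G between its ends missing an end of e.
-- Let S_f be the node set of a shortest one.  Another edge g inside S_f has a
-- strictly shorter such walk, so these points form a triangular system, which
-- together with the all-one vector spans the hyperplane x_e = 1.

module Submission where

open import Defs
open import Data.Bool using (if_then_else_)
open import Data.Fin as Fin using (Fin; zero; suc; _≟_; punchIn; punchOut)
open import Data.Fin.Properties using (any?; <-asym; <⇒≢; injective⇒≤; punchInᵢ≢i; punchIn-punchOut)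
open import Data.Fin.Subset as Subset using (Subset; _∈_; _∉_; _⊆_; _─_; ∁; ⁅_⁆)
open import Data.Fin.Subset.Induction using (⊂-wellFounded)
open import Data.Fin.Subset.Properties using (∉⊥; x∈⁅x⁆; x∈⁅y⁆⇒x≡y; x∈p∪q⁺; x∈p∪q⁻; x∈p∧x≢y⇒x∈p-y; x∈p∧x∉q⇒x∈p─q; p─q⊆p; x∉p⇒x∈∁p; ⊆-antisym; _∈?_)
open import Data.List as List using (List; []; _∷_; _++_; allFin)
open import Data.List.Membership.Propositional using () renaming (_∈_ to _∈ˡ_)
open import Data.List.Membership.Propositional.Properties using (∈-lookup; ∈-allFin)
open import Data.List.Relation.Binary.Permutation.Propositional using (_↭_; ↭⇒↭ₛ)
open import Data.List.Relation.Binary.Permutation.Propositional.Properties using (↭-length; ++-comm)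
open import Data.List.Relation.Unary.All as All using (All; []; _∷_)
open import Data.List.Relation.Unary.AllPairs using ([]; _∷_)
open import Data.List.Relation.Unary.Any using (here; there)
open import Data.List.Relation.Unary.Unique.Propositional using (Unique)
open import Data.Nat as ℕ using (ℕ; zero; suc; z≤n; s≤s)
open import Data.Nat.Induction using (<-rec)
import Data.Nat.Properties as ℕ
open import Data.Product as Product using (∃; Σ; _×_; _,_; proj₁; proj₂)
open import Data.Sum as Sum using (_⊎_; inj₁; inj₂; [_,_]′; swap)
open import Data.Vec as Vec using (lookup; tabulate)
open import Data.Vec.Functional using (Vector; removeAt) renaming (_∷_ to _∷ᵛ_)
open import Data.Vec.Properties using ([]=⇒lookup; lookup⇒[]=; lookup∘tabulate)
open import Function using (_∘_; _$_; id)
open import Function.Bundles using (_⇔_; mk⇔)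
open import Induction.WellFounded using (Acc; acc)
open import Relation.Binary using (IsDecTotalOrder)
open import Relation.Binary.PropositionalEquality as ≡ using (_≡_; _≢_; subst)
open import Relation.Nullary using (¬_; Dec; yes; no; ¬?; does; contradiction; _×-dec_)
open import Relation.Nullary.Decidable as Dec using (dec-true; dec-false; decidable-stable; _⊎-dec_)
open import Relation.Unary using (Pred; Decidable)
import Algebra.Properties.CommutativeMonoid.Sum as CommutativeMonoidSum
import Algebra.Properties.Group as GroupProperties
import Algebra.Properties.Ring as RingProperties
import Algebra.Properties.Semiring.Sum as SemiringSum
import Data.List.Membership.DecPropositional as DecMembership
import Data.List.Relation.Binary.Permutation.Setoid.Properties as ↭
import Relation.Binary.Reasoning.Setoid as SetoidReasoning

-- Ordered fields and finite sums.

module OrderedFieldProperties {c ℓ₁ ℓ₂} (K : OrderedField c ℓ₁ ℓ₂) where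
  open OrderedField K hiding (zero)
  open Polytope K
  open CommutativeMonoidSum +-commutativeMonoid public
    using (sum-cong-≋; sum-remove; ∑-distrib-+; sum-replicate-zero)
  open SemiringSum semiring public using (*-distribʳ-sum)
  open RingProperties ring using (-‿distribˡ-*; -1*x≈-x)
  open GroupProperties +-group using (⁻¹-involutive; //-rightDividesˡ)
  open IsDecTotalOrder isDecTotalOrder public using (antisym; total)
    renaming ( refl to ≤-refl; trans to ≤-trans; reflexive to ≤-reflexive
             ; ≤-respˡ-≈ to ≤-respˡ; ≤-respʳ-≈ to ≤-respʳ; _≟_ to _≈?_ )
  open SetoidReasoning setoid

  y≈0∧x+y≈0⇒x≈0 : ∀ {x y} → y ≈ 0# → x + y ≈ 0# → x ≈ 0#
  y≈0∧x+y≈0⇒x≈0 {x} y≈0 eq = trans (sym (trans (+-congˡ y≈0) (+-identityʳ x))) eq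

  x≈0∧x+y≈0⇒y≈0 : ∀ {x y} → x ≈ 0# → x + y ≈ 0# → y ≈ 0#
  x≈0∧x+y≈0⇒y≈0 {x} {y} x≈0 eq = y≈0∧x+y≈0⇒x≈0 x≈0 (trans (+-comm y x) eq)

  +-monoˡ-≤ : ∀ x {y z} → y ≤ z → y + x ≤ z + x
  +-monoˡ-≤ x {y} {z} y≤z =
    ≤-respˡ (+-comm x y) (≤-respʳ (+-comm x z) (+-monoʳ-≤ x y≤z))

  +-mono-≤ : ∀ {w x y z} → w ≤ x → y ≤ z → w + y ≤ x + z
  +-mono-≤ {x = x} {y} w≤x y≤z = ≤-trans (+-monoˡ-≤ y w≤x) (+-monoʳ-≤ x y≤z)

  x≤y⇒0≤y-x : ∀ {x y} → x ≤ y → 0# ≤ y - x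
  x≤y⇒0≤y-x {x} x≤y = ≤-respˡ (-‿inverseʳ x) (+-monoˡ-≤ (- x) x≤y)

  *-monoˡ-≤ : ∀ {x y z} → 0# ≤ x → y ≤ z → x * y ≤ x * z
  *-monoˡ-≤ {x} {y} {z} 0≤x y≤z =
    ≤-respˡ (+-identityˡ (x * y)) $
    ≤-respʳ (trans (sym (distribˡ x (z - y) y)) (*-congˡ (//-rightDividesˡ y z))) $
    +-monoˡ-≤ (x * y) (*-nonneg 0≤x (x≤y⇒0≤y-x y≤z))

  -- If `1# ≤ 0#`, then `- 1#` is nonnegative, and so is its square, which is `1#`.
  0≤1 : 0# ≤ 1#
  0≤1 with total 0# 1#
  ... | inj₁ 0≤1 = 0≤1
  ... | inj₂ 1≤0 = ≤-respʳ [-1][-1]≈1 (*-nonneg 0≤-1 0≤-1)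
    where
    0≤-1 : 0# ≤ - 1#
    0≤-1 = ≤-respʳ (+-identityˡ (- 1#)) (x≤y⇒0≤y-x 1≤0)
    [-1][-1]≈1 : - 1# * - 1# ≈ 1#
    [-1][-1]≈1 = trans (-1*x≈-x (- 1#)) (⁻¹-involutive 1#)

  1≰0 : ¬ (1# ≤ 0#)
  1≰0 1≤0 = 1≉0 (antisym 1≤0 0≤1)

  x≈0⇒1-x≈1 : ∀ {x} → x ≈ 0# → 1# - x ≈ 1#
  x≈0⇒1-x≈1 {x} x≈0 = trans (sym (+-identityʳ _)) (trans (+-congˡ (sym x≈0)) (//-rightDividesˡ x 1#))

  x≈1⇒1-x≈0 : ∀ {x} → x ≈ 1# → 1# - x ≈ 0#
  x≈1⇒1-x≈0 {x} x≈1 = trans (+-congʳ (sym x≈1)) (-‿inverseʳ x)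

  sum-zero : ∀ {k} {f : Vector Carrier k} → (∀ i → f i ≈ 0#) → sum f ≈ 0#
  sum-zero {k} f≈0 = trans (sum-cong-≋ f≈0) (sum-replicate-zero k)

  sum-mono : ∀ {k} {f g : Vector Carrier k} → (∀ i → f i ≤ g i) → sum f ≤ sum g
  sum-mono {zero}  f≤g = ≤-refl
  sum-mono {suc k} f≤g = +-mono-≤ (f≤g zero) (sum-mono (f≤g ∘ suc))

  sum-nonneg : ∀ {k} {f : Vector Carrier k} → (∀ i → 0# ≤ f i) → 0# ≤ sum f
  sum-nonneg {k} 0≤f = ≤-respˡ (sum-replicate-zero k) (sum-mono 0≤f)

  term≤sum : ∀ {k} {f : Vector Carrier k} → (∀ i → 0# ≤ f i) → ∀ i → f i ≤ sum f
  term≤sum {suc k} {f} 0≤f i =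
    ≤-respˡ (+-identityʳ (f i)) $
    ≤-respʳ (sym (sum-remove {i = i} f)) $
    +-monoʳ-≤ (f i) (sum-nonneg (λ j → 0≤f (punchIn i j)))

  sum-single : ∀ {k} (f : Vector Carrier k) i →
               (∀ j → j ≢ i → f j ≈ 0#) → sum f ≈ f i
  sum-single {suc k} f i f≈0 = begin
    sum f                     ≈⟨ sum-remove {i = i} f ⟩
    f i + sum (removeAt f i)  ≈⟨ +-congˡ (sum-zero λ j → f≈0 (punchIn i j) (punchInᵢ≢i i j)) ⟩
    f i + 0#                  ≈⟨ +-identityʳ (f i) ⟩
    f i                       ∎

  unit-· : ∀ {m} (e : Fin m) (x : Point m) → unit e · x ≈ x e
  unit-· e x = begin
    unit e · x      ≈⟨ sum-single _ e off ⟩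
    unit e e * x e  ≈⟨ *-congʳ on ⟩
    1# * x e        ≈⟨ *-identityˡ (x e) ⟩
    x e             ∎
    where
    on : unit e e ≈ 1#
    on rewrite dec-true (e ≟ e) ≡.refl = refl
    off : ∀ i → i ≢ e → unit e i * x i ≈ 0#
    off i i≢e rewrite dec-false (i ≟ e) i≢e = zeroˡ (x i)

  -- Inequalities on convex hulls.

  module _ {m ℓ} {S : Pred (Point m) ℓ} where

    Conv-⊇ : ∀ {x} → S x → Conv S x
    Conv-⊇ {x} Sx =
      1 , (λ _ → 1#) , (λ _ → x) , (λ _ → Sx) , (λ _ → 0≤1) , +-identityʳ 1# ,
      λ e → sym (trans (+-identityʳ _) (*-identityˡ (x e)))

    Conv-mono : ∀ {e f} → (∀ x → S x → x e ≤ x f) → ∀ {x} → Conv S x → x e ≤ x f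
    Conv-mono {e} {f} le (k , λs , ps , Sps , 0≤λs , _ , eq) =
      ≤-respˡ (sym (eq e)) $ ≤-respʳ (sym (eq f)) $
      sum-mono (λ i → *-monoˡ-≤ (0≤λs i) (le (ps i) (Sps i)))

    Conv-≤1 : ∀ {e} → (∀ x → S x → x e ≤ 1#) → ∀ {x} → Conv S x → x e ≤ 1#
    Conv-≤1 {e} le (k , λs , ps , Sps , 0≤λs , Σλ≈1 , eq) =
      ≤-respˡ (sym (eq e)) $ ≤-respʳ (trans (sum-cong-≋ (λ i → *-identityʳ (λs i))) Σλ≈1) $
      sum-mono (λ i → *-monoˡ-≤ (0≤λs i) (le (ps i) (Sps i)))

  -- Linear and affine independence.

  LinearlyIndependent : ∀ {m k} → Vector (Point m) k → Set _
  LinearlyIndependent {k = k} vs =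
    ∀ (λs : Vector Carrier k) → (∀ e → combination λs vs e ≈ 0#) → ∀ i → λs i ≈ 0#

  xyz+xw≈x[w+yz] : ∀ x y z w → x * y * z + x * w ≈ x * (w + y * z)
  xyz+xw≈x[w+yz] x y z w = begin
    x * y * z + x * w    ≈⟨ +-comm _ _ ⟩
    x * w + x * y * z    ≈⟨ +-congˡ (*-assoc x y z) ⟩
    x * w + x * (y * z)  ≈⟨ distribˡ x w (y * z) ⟨
    x * (w + y * z)      ∎

  -- Eliminate a nonzero coordinate of the head from all other vectors.
  linearlyDependent : ∀ {m} (vs : Vector (Point m) (suc m)) → ¬ LinearlyIndependent vs
  linearlyDependent {m} vs indep with any? (λ i → ¬? (vs zero i ≈? 0#))
  ... | no head≈0 = 1≉0 (indep (1# ∷ᵛ λ _ → 0#) combination≈0 zero)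
    where
    combination≈0 : ∀ e → combination (1# ∷ᵛ λ _ → 0#) vs e ≈ 0#
    combination≈0 e with vs zero e ≈? 0#
    ... | no ≉0 = contradiction (e , ≉0) head≈0
    ... | yes ≈0 = trans (+-cong (trans (*-identityˡ _) ≈0) (sum-zero (λ j → zeroˡ (vs (suc j) e))))
                         (+-identityʳ 0#)
  linearlyDependent {suc m} vs indep | yes (i , vᵢ≉0) with inverse (vs zero i) vᵢ≉0
  -- A relation `λs` among the `w j` lifts to one among `vs` with head coefficient `s λs`. The
  -- deleted coordinate `i` vanishes on every `w j` by the choice of `factor`.
  ... | r , vr≈1 = linearlyDependent (λ j → removeAt (w j) i) λ λs eq j →
    indep (s λs ∷ᵛ λs) (λ e → trans (reduce λs e) (vanish λs eq e)) (suc j)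
    where
    factor : Fin (suc m) → Carrier
    factor j = - (vs (suc j) i * r)
    w : Vector (Point (suc m)) (suc m)
    w j e = vs (suc j) e + factor j * vs zero e
    s : Vector Carrier (suc m) → Carrier
    s λs = sum (λ j → λs j * factor j)
    w≈0 : ∀ j → w j i ≈ 0#
    w≈0 j = begin
      a + - (a * r) * v    ≈⟨ +-congˡ (-‿distribˡ-* (a * r) v) ⟨
      a + - ((a * r) * v)  ≈⟨ +-congˡ (-‿cong (trans (*-assoc a r v) (*-congˡ (trans (*-comm r v) vr≈1)))) ⟩
      a + - (a * 1#)       ≈⟨ +-congˡ (-‿cong (*-identityʳ a)) ⟩
      a - a                ≈⟨ -‿inverseʳ a ⟩
      0#                   ∎
      where
      a = vs (suc j) i
      v = vs zero i
    reduce : ∀ λs e → combination (s λs ∷ᵛ λs) vs e ≈ combination λs w e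
    reduce λs e = begin
      s λs * v + sum (λ j → λs j * b j)
        ≈⟨ +-congʳ (*-distribʳ-sum v (λ j → λs j * factor j)) ⟩
      sum (λ j → λs j * factor j * v) + sum (λ j → λs j * b j)
        ≈⟨ ∑-distrib-+ (λ j → λs j * factor j * v) (λ j → λs j * b j) ⟨
      sum (λ j → λs j * factor j * v + λs j * b j)
        ≈⟨ sum-cong-≋ (λ j → xyz+xw≈x[w+yz] (λs j) (factor j) v (b j)) ⟩
      combination λs w e ∎
      where
      v = vs zero e
      b : Fin (suc m) → Carrier
      b j = vs (suc j) e
    vanish : ∀ λs → (∀ e → combination λs (λ j → removeAt (w j) i) e ≈ 0#) →
             ∀ e → combination λs w e ≈ 0#
    vanish λs eq e with i ≟ e
    ... | yes ≡.refl = sum-zero (λ j → trans (*-congˡ (w≈0 j)) (zeroʳ (λs j)))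
    ... | no i≢e = ≡.subst (λ e → combination λs w e ≈ 0#) (punchIn-punchOut i≢e) (eq (punchOut i≢e))

  -- An additional coordinate `1#` turns affine into linear independence: in that coordinate, a
  -- combination is the sum of its coefficients.
  affinelyDependent : ∀ {m} (ps : Vector (Point m) (suc (suc m))) → ¬ AffinelyIndependent ps
  affinelyDependent ps indep = linearlyDependent (λ i → 1# ∷ᵛ ps i) λ λs eq →
    indep λs (trans (sum-cong-≋ (λ i → sym (*-identityʳ (λs i)))) (eq zero)) (eq ∘ suc)

  -- Coordinate `e` of a vanishing combination is the coefficient sum over `ps` alone, so the
  -- coefficient of `q` is 0. Each use raises the dimension by one.
  affinelyIndependent-∷ᵛ : ∀ {m k} (ps : Vector (Point m) k) {q} e → q e ≈ 0# →
                          (∀ i → ps i e ≈ 1#) → AffinelyIndependent ps →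
                          AffinelyIndependent (q ∷ᵛ ps)
  affinelyIndependent-∷ᵛ ps {q} e qₑ≈0 psₑ≈1 indep λs Σλ≈0 eq = λ where
      zero    → λ₀≈0
      (suc i) → indep (λs ∘ suc) Στ≈0
        (λ f → x≈0∧x+y≈0⇒y≈0 (trans (*-congʳ λ₀≈0) (zeroˡ (q f))) (eq f)) i
    where
    Στ≈0 : sum (λs ∘ suc) ≈ 0#
    Στ≈0 = trans (sum-cong-≋ (λ i → sym (trans (*-congˡ (psₑ≈1 i)) (*-identityʳ _))))
                 (x≈0∧x+y≈0⇒y≈0 (trans (*-congˡ qₑ≈0) (zeroʳ (λs zero))) (eq e))
    λ₀≈0 : λs zero ≈ 0#
    λ₀≈0 = y≈0∧x+y≈0⇒x≈0 Στ≈0 Σλ≈0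

  -- Coefficients vanish in order of decreasing rank, starting from the bound `N`; that of index `e`
  -- comes last, from the coefficient sum.
  affinelyIndependent-triangular :
    ∀ {m} (ps : Vector (Point m) m) (e : Fin m) (rank : Fin m → ℕ) N →
    (∀ i → rank i ℕ.≤ N) →
    (∀ i → i ≢ e → ps i i ≈ 0#) →
    (∀ i j → i ≢ j → j ≢ e → (i ≢ e × rank j ℕ.< rank i) ⊎ ps i j ≈ 1#) →
    AffinelyIndependent ps
  affinelyIndependent-triangular {suc m} ps e rank N rank≤N diag off λs Σλ≈0 eq = all≈0
    where
    -- Coordinate j of the combination is Σλ - λⱼ, up to terms λᵢ (pᵢⱼ - 1)
    -- with rank j < rank i.
    off-e≈0 : ∀ k j → N ℕ.< rank j ℕ.+ k → j ≢ e → λs j ≈ 0#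
    off-e≈0 zero j N<rank j≢e =
      contradiction (rank≤N j) (ℕ.<⇒≱ (≡.subst (N ℕ.<_) (ℕ.+-identityʳ (rank j)) N<rank))
    off-e≈0 (suc k) j N<rank j≢e = y≈0∧x+y≈0⇒x≈0 rest≈0 (trans (sym (sum-remove λs)) Σλ≈0)
      where
      term : ∀ i → i ≢ j → λs i * ps i j ≈ λs i
      term i i≢j with off i j i≢j j≢e
      ... | inj₂ pᵢⱼ≈1 = trans (*-congˡ pᵢⱼ≈1) (*-identityʳ (λs i))
      -- The rank of `i` is larger, so the induction on `k` already gives `λs i ≈ 0#`, and both
      -- sides are 0.
      ... | inj₁ (i≢e , j<i) = trans (*-congʳ λᵢ≈0) (trans (zeroˡ (ps i j)) (sym λᵢ≈0))
        where
        λᵢ≈0 : λs i ≈ 0#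
        λᵢ≈0 = off-e≈0 k i (ℕ.≤-trans N<rank
          (≡.subst (ℕ._≤ rank i ℕ.+ k) (≡.sym (ℕ.+-suc (rank j) k)) (ℕ.+-monoˡ-≤ k j<i))) i≢e
      rest≈0 : sum (removeAt λs j) ≈ 0#
      rest≈0 = begin
        sum (removeAt λs j)
          ≈⟨ sum-cong-≋ (λ i → term (punchIn j i) (punchInᵢ≢i j i)) ⟨
        sum (removeAt (λ i → λs i * ps i j) j)
          ≈⟨ x≈0∧x+y≈0⇒y≈0 (trans (*-congˡ (diag j j≢e)) (zeroʳ (λs j)))
                       (trans (sym (sum-remove (λ i → λs i * ps i j))) (eq j)) ⟩
        0# ∎

    all≈0 : ∀ i → λs i ≈ 0#
    all≈0 i with i ≟ e
    ... | no i≢e = off-e≈0 (suc N) i (ℕ.m≤n+m (suc N) (rank i)) i≢e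
    ... | yes ≡.refl = trans (sym (sum-single λs e λ j j≢e →
                         off-e≈0 (suc N) j (ℕ.m≤n+m (suc N) (rank j)) j≢e)) Σλ≈0

-- Least numbers and lists without repetition.

least : ∀ {P : ℕ → Set} → Decidable P → ∀ {k} → P k →
        ∃ λ j → j ℕ.≤ k × P j × (∀ {i} → P i → j ℕ.≤ i)
least {P} P? {k} = <-rec Q search k
  where
  Q : ℕ → Set
  Q k = P k → ∃ λ j → j ℕ.≤ k × P j × (∀ {i} → P i → j ℕ.≤ i)
  search : ∀ k → (∀ {j} → j ℕ.< k → Q j) → Q k
  search k rec Pk with ℕ.anyUpTo? P? k
  ... | yes (j , j<k , Pj) with rec j<k Pj
  ...   | i , i≤j , Pi , min = i , ℕ.≤-trans i≤j (ℕ.<⇒≤ j<k) , Pi , min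
  search k rec Pk | no none = k , ℕ.≤-refl , Pk , λ Pi → ℕ.≮⇒≥ λ i<k → none (_ , i<k , Pi)

lookup-injective : ∀ {a} {A : Set a} {xs : List A} → Unique xs → ∀ {i j} →
                   List.lookup xs i ≡ List.lookup xs j → i ≡ j
lookup-injective (_   ∷ _)  {zero}  {zero}  _  = ≡.refl
lookup-injective (x∉ ∷ _)  {zero}  {suc j} eq = contradiction eq (All.lookup x∉ (∈-lookup j))
lookup-injective (x∉ ∷ _)  {suc i} {zero}  eq = contradiction (≡.sym eq) (All.lookup x∉ (∈-lookup i))
lookup-injective (_   ∷ un) {suc i} {suc j} eq = ≡.cong suc (lookup-injective un eq)

-- Pigeonhole principle: the positions of the list inject into `Fin n`.
Unique⇒length≤ : ∀ {n} {xs : List (Fin n)} → Unique xs → List.length xs ℕ.≤ n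
Unique⇒length≤ un = injective⇒≤ (lookup-injective un)

-- Walks, paths, cycles and cut-vertices.

module WalkProperties {n m : ℕ} (G′ : Graph n m) where
  open Graph G′
  open Subgraph G′

  private
    variable
      A B : Subset m
      s t u v w : Fin n
      e f : Fin m

  Joins-sym : Joins e u v → Joins e v u
  Joins-sym = swap

  joins : ∀ e → Joins e (src e) (tgt e)
  joins e = inj₁ (≡.refl , ≡.refl)

  Joins⇒≢ : Joins e u v → u ≢ v
  Joins⇒≢ {e} (inj₁ (≡.refl , ≡.refl)) = <⇒≢ (src<tgt e)
  Joins⇒≢ {e} (inj₂ (≡.refl , ≡.refl)) = <⇒≢ (src<tgt e) ∘ ≡.sym

  -- Equal orientations reduce to `simple`; opposite ones contradict `src<tgt`.
  Joins-injective : Joins e u v → Joins f u v → e ≡ f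
  Joins-injective {e} {f = f} (inj₁ (≡.refl , ≡.refl)) (inj₁ (p , q)) = simple e f (≡.sym p) (≡.sym q)
  Joins-injective {e} {f = f} (inj₂ (≡.refl , ≡.refl)) (inj₂ (p , q)) = simple e f (≡.sym p) (≡.sym q)
  Joins-injective {e} {f = f} (inj₁ (≡.refl , ≡.refl)) (inj₂ (p , q)) =
    contradiction (≡.subst₂ Fin._<_ p q (src<tgt f)) (<-asym (src<tgt e))
  Joins-injective {e} {f = f} (inj₂ (≡.refl , ≡.refl)) (inj₁ (p , q)) =
    contradiction (≡.subst₂ Fin._<_ p q (src<tgt f)) (<-asym (src<tgt e))

  Joins-other : Joins e u v → Joins e u w → v ≡ w
  Joins-other (inj₁ (≡.refl , ≡.refl)) (inj₁ (_ , q)) = q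
  Joins-other (inj₂ (≡.refl , ≡.refl)) (inj₂ (q , _)) = q
  Joins-other j@(inj₁ (≡.refl , ≡.refl)) (inj₂ (_ , q)) = contradiction (≡.sym q) (Joins⇒≢ j)
  Joins-other j@(inj₂ (≡.refl , ≡.refl)) (inj₁ (q , _)) = contradiction (≡.sym q) (Joins⇒≢ j)

  len : Walk A u w → ℕ
  len p = List.length (laterNodes p)

  last∈nodes : (p : Walk A u w) → w ∈ˡ nodes p
  last∈nodes []             = here ≡.refl
  last∈nodes (step _ _ _ p) = there (last∈nodes p)

  edges⊆ : (p : Walk A u w) → edges p ⊆ A
  edges⊆ []              e∈ = contradiction e∈ ∉⊥
  edges⊆ (step f f∈A _ p) e∈ with x∈p∪q⁻ ⁅ f ⁆ (edges p) e∈
  ... | inj₁ e∈f = subst (_∈ _) (≡.sym (x∈⁅y⁆⇒x≡y f e∈f)) f∈A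
  ... | inj₂ e∈p = edges⊆ p e∈p

  edge-end∈nodes : (p : Walk A u w) → e ∈ edges p → Joins e s t → s ∈ˡ nodes p
  edge-end∈nodes [] e∈ _ = contradiction e∈ ∉⊥
  edge-end∈nodes (step f _ j p) e∈ j′ with x∈p∪q⁻ ⁅ f ⁆ (edges p) e∈
  ... | inj₂ e∈p = there (edge-end∈nodes p e∈p j′)
  ... | inj₁ e∈f with x∈⁅y⁆⇒x≡y f e∈f
  edge-end∈nodes (step f _ (inj₁ (≡.refl , ≡.refl)) p) e∈ (inj₁ (≡.refl , ≡.refl)) | inj₁ _ | ≡.refl = here ≡.refl
  edge-end∈nodes (step f _ (inj₁ (≡.refl , ≡.refl)) p) e∈ (inj₂ (≡.refl , ≡.refl)) | inj₁ _ | ≡.refl = there (here ≡.refl)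
  edge-end∈nodes (step f _ (inj₂ (≡.refl , ≡.refl)) p) e∈ (inj₁ (≡.refl , ≡.refl)) | inj₁ _ | ≡.refl = there (here ≡.refl)
  edge-end∈nodes (step f _ (inj₂ (≡.refl , ≡.refl)) p) e∈ (inj₂ (≡.refl , ≡.refl)) | inj₁ _ | ≡.refl = here ≡.refl

  restrict : (p : Walk A u w) → edges p ⊆ B → Walk B u w
  restrict []             _  = []
  restrict (step e _ j p) p⊆ =
    step e (p⊆ (x∈p∪q⁺ (inj₁ (x∈⁅x⁆ e)))) j (restrict p (p⊆ ∘ x∈p∪q⁺ ∘ inj₂))

  laterNodes-restrict : (p : Walk A u w) (p⊆ : edges p ⊆ B) →
                        laterNodes (restrict p p⊆) ≡ laterNodes p
  laterNodes-restrict []             _  = ≡.refl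
  laterNodes-restrict (step e _ j p) p⊆ = ≡.cong (_ ∷_) (laterNodes-restrict p _)

  edges-restrict : (p : Walk A u w) (p⊆ : edges p ⊆ B) → edges (restrict p p⊆) ≡ edges p
  edges-restrict []             _  = ≡.refl
  edges-restrict (step e _ j p) p⊆ = ≡.cong (⁅ e ⁆ Subset.∪_) (edges-restrict p _)

  infixr 5 _⊙_
  _⊙_ : Walk A u v → Walk A v w → Walk A u w
  []               ⊙ q = q
  step e e∈A j p ⊙ q = step e e∈A j (p ⊙ q)

  laterNodes-⊙ : (p : Walk A u v) (q : Walk A v w) →
                 laterNodes (p ⊙ q) ≡ laterNodes p ++ laterNodes q
  laterNodes-⊙ []             q = ≡.refl
  laterNodes-⊙ (step _ _ _ p) q = ≡.cong (_ ∷_) (laterNodes-⊙ p q)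

  edges-⊙ : (p : Walk A u v) (q : Walk A v w) → edges (p ⊙ q) ⊆ edges p Subset.∪ edges q
  edges-⊙ []             q e∈ = x∈p∪q⁺ (inj₂ e∈)
  edges-⊙ (step f _ _ p) q e∈ with x∈p∪q⁻ ⁅ f ⁆ (edges (p ⊙ q)) e∈
  ... | inj₁ e∈f = x∈p∪q⁺ (inj₁ (x∈p∪q⁺ (inj₁ e∈f)))
  ... | inj₂ e∈pq with x∈p∪q⁻ (edges p) (edges q) (edges-⊙ p q e∈pq)
  ...   | inj₁ e∈p = x∈p∪q⁺ (inj₁ (x∈p∪q⁺ (inj₂ e∈p)))
  ...   | inj₂ e∈q = x∈p∪q⁺ (inj₂ e∈q)

  -- The length is an index so that `leg?` can recurse on it. `T` will be avoidance of a node or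
  -- membership in a node list.
  Leg : Subset m → (Fin n → Set) → ℕ → Fin n → Fin n → Set
  Leg A T k u w = Σ (Walk A u w) λ p → All T (nodes p) × len p ≡ k

  module _ {T : Fin n → Set} where

    snoc : ∀ {k} → Leg A T k u v → e ∈ A → Joins e v w → T w → Leg A T (suc k) u w
    snoc ([] , Tp , ≡.refl) e∈A j Tw = step _ e∈A j [] , All.head Tp ∷ Tw ∷ [] , ≡.refl
    snoc (step f f∈A i p , Tu ∷ Tp , ≡.refl) e∈A j Tw with snoc (p , Tp , ≡.refl) e∈A j Tw
    ... | q , Tq , eq = step f f∈A i q , Tu ∷ Tq , ≡.cong suc eq

    reverse : ∀ {k} → Leg A T k u w → Leg A T k w u
    reverse ([] , Tp , ≡.refl) = [] , Tp , ≡.refl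
    reverse (step e e∈A j p , Tu ∷ Tp , ≡.refl) = snoc (reverse (p , Tp , ≡.refl)) e∈A (Joins-sym {e} j) Tu

    prefix : (p : Walk A u w) → All T (nodes p) → t ∈ˡ nodes p →
             ∃ λ k → Leg A T k u t × k ℕ.≤ len p × (k ℕ.< len p ⊎ t ≡ w)
    prefix []             Tp        (here ≡.refl) = 0 , ([] , Tp , ≡.refl) , z≤n , inj₂ ≡.refl
    prefix (step _ _ _ p) (Tu ∷ _)  (here ≡.refl) = 0 , ([] , Tu ∷ [] , ≡.refl) , z≤n , inj₁ (s≤s z≤n)
    prefix (step e e∈A j p) (Tu ∷ Tp) (there t∈) with prefix p Tp t∈
    ... | k , (q , Tq , ≡.refl) , k≤ , c =
      suc k , (step e e∈A j q , Tu ∷ Tq , ≡.refl) , s≤s k≤ , Sum.map₁ s≤s c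

    -- The section of `p` between the two nodes, reversed if `t` comes first. Its strict shortness,
    -- unless `s` and `t` are the ends of `p`, drives the later descents on length.
    between : (p : Walk A u w) → All T (nodes p) → s ∈ˡ nodes p → t ∈ˡ nodes p →
              ∃ λ k → Leg A T k s t × k ℕ.≤ len p ×
                      (k ℕ.< len p ⊎ (s ≡ u × t ≡ w) ⊎ (s ≡ w × t ≡ u))
    between p Tp (here ≡.refl) t∈ with prefix p Tp t∈
    ... | k , q , k≤ , c = k , q , k≤ , Sum.map₂ (λ t≡w → inj₁ (≡.refl , t≡w)) c
    between p@(step _ _ _ _) Tp s∈@(there _) (here ≡.refl) with prefix p Tp s∈
    ... | k , q , k≤ , c = k , reverse q , k≤ , Sum.map₂ (λ s≡w → inj₂ (s≡w , ≡.refl)) c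
    between (step _ _ _ p) (_ ∷ Tp) (there s∈) (there t∈) with between p Tp s∈ t∈
    ... | k , q , k≤ , _ = k , q , ℕ.m≤n⇒m≤1+n k≤ , inj₁ (s≤s k≤)

    module _ (T? : Decidable T) where

      -- Recursion on the length, with a finite search for the first edge and the node it leads to.
      leg? : ∀ A k u w → Dec (Leg A T k u w)
      leg? A zero u w = Dec.map′ to from (u ≟ w ×-dec T? u)
        where
        to : u ≡ w × T u → Leg A T 0 u w
        to (≡.refl , Tu) = [] , Tu ∷ [] , ≡.refl
        from : Leg A T 0 u w → u ≡ w × T u
        from ([] , Tu ∷ [] , _) = ≡.refl , Tu
      leg? A (suc k) u w = Dec.map′ to from
        (T? u ×-dec any? λ e → e ∈? A ×-dec any? λ v → joins? e v ×-dec leg? A k v w)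
        where
        joins? : ∀ e v → Dec (Joins e u v)
        joins? e v = (src e ≟ u ×-dec tgt e ≟ v) ⊎-dec (src e ≟ v ×-dec tgt e ≟ u)
        to : (T u × ∃ λ e → e ∈ A × ∃ λ v → Joins e u v × Leg A T k v w) → Leg A T (suc k) u w
        to (Tu , e , e∈A , v , j , p , Tp , eq) = step e e∈A j p , Tu ∷ Tp , ≡.cong suc eq
        from : Leg A T (suc k) u w → T u × ∃ λ e → e ∈ A × ∃ λ v → Joins e u v × Leg A T k v w
        from (step e e∈A j p , Tu ∷ Tp , eq) = Tu , e , e∈A , _ , j , p , Tp , ℕ.suc-injective eq

  nodes-self : (p : Walk A u w) → All (_∈ˡ nodes p) (nodes p)
  nodes-self p = All.tabulate id

  suffix : (p : Walk A v w) → Unique (nodes p) → u ∈ˡ nodes p →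
           Σ (Walk A u w) λ q → Unique (nodes q) × (∀ {x} → x ∈ˡ nodes q → x ∈ˡ nodes p) ×
                                len q ℕ.≤ len p
  suffix p un (here ≡.refl) = p , un , id , ℕ.≤-refl
  suffix (step _ _ _ p) (_ ∷ un) (there u∈) with suffix p un u∈
  ... | q , unq , q⊆ , q≤ = q , unq , there ∘ q⊆ , ℕ.m≤n⇒m≤1+n q≤

  -- The tail is loop-erased first; if the start node recurs in it, only the suffix from there is
  -- kept.
  loopErase : (p : Walk A u w) →
              Σ (Walk A u w) λ q → Unique (nodes q) × (∀ {x} → x ∈ˡ nodes q → x ∈ˡ nodes p) ×
                                   len q ℕ.≤ len p
  loopErase [] = [] , [] ∷ [] , id , ℕ.≤-refl
  loopErase {u = u} (step e e∈A j p) with loopErase p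
  ... | q , unq , q⊆ , q≤ with DecMembership._∈?_ _≟_ u (nodes q)
  ...   | yes u∈q with suffix q unq u∈q
  ...     | r , unr , r⊆ , r≤ = r , unr , there ∘ q⊆ ∘ r⊆ , ℕ.m≤n⇒m≤1+n (ℕ.≤-trans r≤ q≤)
  loopErase {u = u} (step e e∈A j p) | q , unq , q⊆ , q≤ | no u∉q =
    step e e∈A j q , All.tabulate (λ {x} x∈q u≡x → u∉q (subst (_∈ˡ nodes q) (≡.sym u≡x) x∈q)) ∷ unq ,
    (λ { (here x≡u) → here x≡u ; (there x∈q) → there (q⊆ x∈q) }) , s≤s q≤

  -- As `u` does not recur, only the first edge could be `e`; but then `w` would be reached after
  -- one step and again at the end.
  chord∉edges : (p : Walk A u w) → Unique (nodes p) → 2 ℕ.≤ len p → Joins e u w → e ∉ edges p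
  chord∉edges {e = e} (step f _ i p) (u∉ ∷ un) len≥2 j e∈ with x∈p∪q⁻ ⁅ f ⁆ (edges p) e∈
  ... | inj₂ e∈p = All.lookup u∉ (edge-end∈nodes p e∈p j) ≡.refl
  ... | inj₁ e∈f with x∈⁅y⁆⇒x≡y f e∈f
  ... | ≡.refl with Joins-other {e} i j
  chord∉edges (step f _ i []) _ (s≤s ()) j e∈ | inj₁ _ | ≡.refl | ≡.refl
  chord∉edges (step f _ i (step _ _ _ p)) (_ ∷ w∉ ∷ _) _ j e∈ | inj₁ _ | ≡.refl | ≡.refl =
    All.lookup w∉ (last∈nodes p) ≡.refl

  -- The equation on nodes is what allows a closed walk to be rotated about `e`.
  splitAt : (p : Walk A u w) → e ∈ edges p →
            ∃ λ s → ∃ λ t → Joins e s t × Σ (Walk A u s) λ p₁ → Σ (Walk A t w) λ p₂ →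
              laterNodes p ≡ laterNodes p₁ ++ nodes p₂ ×
              edges p₁ ⊆ edges p × edges p₂ ⊆ edges p
  splitAt [] e∈ = contradiction e∈ ∉⊥
  splitAt (step f f∈A j p) e∈ with x∈p∪q⁻ ⁅ f ⁆ (edges p) e∈
  ... | inj₁ e∈f with x∈⁅y⁆⇒x≡y f e∈f
  ... | ≡.refl = _ , _ , j , [] , p , ≡.refl , (λ ∈⊥ → contradiction ∈⊥ ∉⊥) , x∈p∪q⁺ ∘ inj₂
  splitAt (step f f∈A j p) e∈ | inj₂ e∈p with splitAt p e∈p
  ... | s , t , i , p₁ , p₂ , eq , p₁⊆ , p₂⊆ =
    s , t , i , step f f∈A j p₁ , p₂ , ≡.cong (_ ∷_) eq ,
    [ x∈p∪q⁺ ∘ inj₁ , x∈p∪q⁺ ∘ inj₂ ∘ p₁⊆ ]′ ∘ x∈p∪q⁻ ⁅ f ⁆ (edges p₁) ,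
    x∈p∪q⁺ ∘ inj₂ ∘ p₂⊆

  -- Rotating the closed walk so that `e` comes last and dropping `e` leaves a path `q`. It still
  -- has at least two edges, so `chord∉edges` keeps `e` off it.
  openCycle : ∀ {C} → IsCycle A C → e ∈ C → ∃ λ s → ∃ λ t → Joins e s t × Walk (C Subset.- e) t s
  openCycle {A = A} {e = e} (v , p , len≥3 , un , ≡.refl) e∈ with splitAt p e∈
  ... | s , t , j , p₁ , p₂ , eq , p₁⊆ , p₂⊆ =
    s , t , j , restrict q λ {g} g∈q →
      x∈p∧x≢y⇒x∈p-y (q⊆ g∈q) λ { ≡.refl → chord∉edges q unq lenq (Joins-sym {e} j) g∈q }
    where
    q : Walk A t s
    q = p₂ ⊙ p₁
    rotation : laterNodes p ↭ nodes q
    rotation = ≡.subst₂ _↭_ (≡.sym eq) (≡.cong (t ∷_) (≡.sym (laterNodes-⊙ p₂ p₁)))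
                 (++-comm (laterNodes p₁) (nodes p₂))
    unq : Unique (nodes q)
    unq = ↭.Unique-resp-↭ (≡.setoid _) (↭⇒↭ₛ rotation) un
    lenq : 2 ℕ.≤ len q
    lenq = ℕ.s≤s⁻¹ (subst (3 ℕ.≤_) (↭-length rotation) len≥3)
    q⊆ : edges q ⊆ edges p
    q⊆ = [ p₂⊆ , p₁⊆ ]′ ∘ x∈p∪q⁻ (edges p₂) (edges p₁) ∘ edges-⊙ p₂ p₁

  -- A path has fewer than `n` edges, so a search among the finitely many lengths below `n` decides
  -- whether some path misses `z`.
  cutVertex-or-avoidable : ∀ A u w z →
    CutVertex A u w z ⊎ (∃ λ k → k ℕ.< n × Leg A (_≢ z) k u w)
  cutVertex-or-avoidable A u w z
    with ℕ.anyUpTo? (λ k → leg? (λ x → ¬? (x ≟ z)) A k u w) n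
  ... | yes leg = inj₂ leg
  ... | no ∄leg = inj₁ λ (p , un) → decidable-stable (DecMembership._∈?_ _≟_ z (nodes p)) λ z∉p →
    ∄leg (len p , Unique⇒length≤ un ,
          p , All.tabulate (λ x∈p x≡z → z∉p (subst (_∈ˡ nodes p) x≡z x∈p)) , ≡.refl)

-- Set difference and inclusion-minimal sets.

x∈p─q⇒x∉q : ∀ {m} (p q : Subset m) {x} → x ∈ p ─ q → x ∉ q
x∈p─q⇒x∉q (_ Vec.∷ p) (_ Vec.∷ q) (Vec.there x∈p─q) (Vec.there x∈q) = x∈p─q⇒x∉q p q x∈p─q x∈q

-- Well-founded induction on strict inclusion. `P` is not assumed decidable, hence the double
-- negation, which suffices for deriving contradictions.
¬¬-minimal : ∀ {m} (P : Subset m → Set) {D} → P D →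
             ¬ ¬ (∃ λ C → C ⊆ D × P C × (∀ D′ → D′ ⊆ C → P D′ → D′ ≡ C))
¬¬-minimal P {D} = go (⊂-wellFounded D)
  where
  go : ∀ {D} → Acc Subset._⊂_ D → P D →
       ¬ ¬ (∃ λ C → C ⊆ D × P C × (∀ D′ → D′ ⊆ C → P D′ → D′ ≡ C))
  go {D} (acc rec) PD none = none (D , id , PD , λ D′ D′⊆D PD′ → ⊆-antisym D′⊆D (D⊆ D′ D′⊆D PD′))
    where
    D⊆ : ∀ D′ → D′ ⊆ D → P D′ → D ⊆ D′
    D⊆ D′ D′⊆D PD′ {x} x∈D = decidable-stable (x ∈? D′) λ x∉D′ →
      go (rec (D′⊆D , x , x∈D , x∉D′)) PD′ λ (C , C⊆D′ , rest) → none (C , D′⊆D ∘ C⊆D′ , rest)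

-- Walks between the ends of an edge that miss an end of `e`.

module RouteProperties {n m : ℕ} (G′ : Graph n m) (A : Subset m) (e : Fin m) where
  open Graph G′
  open Subgraph G′
  open WalkProperties G′

  module _ {f} (f≢e : f ≢ e) (ccv : ConnectsCutVertices A e f) where

    -- If p contains both ends of f, then so does its section between them
    -- contain both ends of e, and yields a shorter walk between the latter.
    detour : Walk A (src e) (tgt e) →
             Σ (Walk A (src e) (tgt e)) λ q → ¬ (src f ∈ˡ nodes q × tgt f ∈ˡ nodes q)
    detour p = <-rec Q go (len p) p ≡.refl
      where
      Q : ℕ → Set
      Q k = (p : Walk A (src e) (tgt e)) → len p ≡ k →
            Σ (Walk A (src e) (tgt e)) λ q → ¬ (src f ∈ˡ nodes q × tgt f ∈ˡ nodes q)
      go : ∀ k → (∀ {j} → j ℕ.< k → Q j) → Q k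
      go _ rec p ≡.refl
        with DecMembership._∈?_ _≟_ (src f) (nodes p) ×-dec DecMembership._∈?_ _≟_ (tgt f) (nodes p)
      ... | no ∉p = p , ∉p
      ... | yes (s∈ , t∈) with between p (nodes-self p) s∈ t∈
      -- This alternative of `between` unfolds to `Joins f (src e) (tgt e)`.
      ...   | _ , _ , _ , inj₂ j = contradiction (Joins-injective {f} j (joins e)) f≢e
      -- Cut-vertices are guaranteed to lie on paths only, so the section is loop-erased before they
      -- are located on it.
      ...   | _ , (q , _ , ≡.refl) , _ , inj₁ q<p with loopErase q
      ...     | r , unr , _ , r≤q
        with between r (nodes-self r) (proj₁ ccv (r , unr)) (proj₂ ccv (r , unr))
      ...       | _ , (p′ , _ , ≡.refl) , p′≤r , _ =
        rec (ℕ.≤-<-trans (ℕ.≤-trans p′≤r r≤q) q<p) p′ ≡.refl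

  -- The nodes of such a walk give a multicut with value 0 on `f` and 1 on `e`.
  Route : Fin m → ℕ → Set
  Route f k = Leg A (_≢ src e) k (src f) (tgt f) ⊎ Leg A (_≢ tgt e) k (src f) (tgt f)

  route? : ∀ f → Decidable (Route f)
  route? f k = leg? (λ x → ¬? (x ≟ src e)) A k (src f) (tgt f)
         ⊎-dec leg? (λ x → ¬? (x ≟ tgt e)) A k (src f) (tgt f)

  routeWalk : ∀ {f k} → Route f k → Walk A (src f) (tgt f)
  routeWalk = [ proj₁ , proj₁ ]′

  record ShortestRoute (f : Fin m) : Set where
    field
      length  : ℕ
      length< : length ℕ.< n
      route   : Route f length
      minimal : ∀ {k} → Route f k → length ℕ.≤ k
    routeNodes : List (Fin n)
    routeNodes = nodes (routeWalk route)

  module _ {f} (f≢e : f ≢ e) (¬ccv : ¬ (f ∈ ∁ A × ConnectsCutVertices A e f)) where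

    -- Otherwise both ends of `e` are cut-vertices for `f`. Then `f` is in `A` by hypothesis and is
    -- itself a path, so its two nodes are the ends of `e`, contradicting `f≢e`.
    route-exists : ∃ λ k → k ℕ.< n × Route f k
    route-exists
      with cutVertex-or-avoidable A (src f) (tgt f) (src e)
         | cutVertex-or-avoidable A (src f) (tgt f) (tgt e)
    ... | inj₂ (k , k<n , leg) | _ = k , k<n , inj₁ leg
    ... | inj₁ _ | inj₂ (k , k<n , leg) = k , k<n , inj₂ leg
    ... | inj₁ cutₛ | inj₁ cutₜ with f ∈? A
    ...   | no f∉A = contradiction (x∉p⇒x∈∁p f∉A , cutₛ , cutₜ) ¬ccv
    ...   | yes f∈A = contradiction (Joins-injective {f} (ends (cutₛ edge) (cutₜ edge)) (joins e)) f≢e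
      where
      edge : Path A (src f) (tgt f)
      edge = step f f∈A (joins f) [] , (Joins⇒≢ {f} (joins f) ∷ []) ∷ [] ∷ []
      ends : src e ∈ˡ src f ∷ tgt f ∷ [] → tgt e ∈ˡ src f ∷ tgt f ∷ [] → Joins f (src e) (tgt e)
      ends (here s≡s)         (there (here t≡t)) = inj₁ (≡.sym s≡s , ≡.sym t≡t)
      ends (there (here s≡t)) (here t≡s)         = inj₂ (≡.sym t≡s , ≡.sym s≡t)
      ends (here s≡s)         (here t≡s)         =
        contradiction (≡.trans s≡s (≡.sym t≡s)) (Joins⇒≢ {e} (joins e))
      ends (there (here s≡t)) (there (here t≡t)) =
        contradiction (≡.trans s≡t (≡.sym t≡t)) (Joins⇒≢ {e} (joins e))

    shortestRoute : ShortestRoute f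
    shortestRoute with route-exists
    ... | k , k<n , r with least (route? f) r
    ...   | j , j≤k , r′ , min = record
      { length = j ; length< = ℕ.≤-<-trans j≤k k<n ; route = r′ ; minimal = min }

  routeWalk-avoids : ∀ {f k} (r : Route f k) →
                     ¬ (src e ∈ˡ nodes (routeWalk r) × tgt e ∈ˡ nodes (routeWalk r))
  routeWalk-avoids (inj₁ (_ , ≢s , _)) (s∈ , _) = All.lookup ≢s s∈ ≡.refl
  routeWalk-avoids (inj₂ (_ , ≢t , _)) (_ , t∈) = All.lookup ≢t t∈ ≡.refl

  -- The section between the ends of `g` misses the same end of `e`. It is strictly shorter, since
  -- only `f` joins the ends of the whole route.
  shorter-route : ∀ {f g k} → g ≢ f → (r : Route f k) →
                  src g ∈ˡ nodes (routeWalk r) → tgt g ∈ˡ nodes (routeWalk r) →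
                  ∃ λ j → j ℕ.< k × Route g j
  shorter-route {f} {g} g≢f (inj₁ (p , Tp , ≡.refl)) s∈ t∈ with between p Tp s∈ t∈
  ... | k , q , _ , inj₁ k< = k , k< , inj₁ q
  ... | _ , _ , _ , inj₂ j = contradiction (Joins-injective {g} j (joins f)) g≢f
  shorter-route {f} {g} g≢f (inj₂ (p , Tp , ≡.refl)) s∈ t∈ with between p Tp s∈ t∈
  ... | k , q , _ , inj₁ k< = k , k< , inj₂ q
  ... | _ , _ , _ , inj₂ j = contradiction (Joins-injective {g} j (joins f)) g≢f

-- Lifted multicuts with one connected cluster.

module LiftedMulticutProperties {c ℓ₁ ℓ₂} (K : OrderedField c ℓ₁ ℓ₂) {n m : ℕ} (G′ : Graph n m) where
  open OrderedField K hiding (zero)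
  open OrderedFieldProperties K
  open Polytope K
  open Graph G′
  open Subgraph G′
  open WalkProperties G′
  open LiftedMulticut K G′

  private
    summand-nonneg : ∀ S {y : Point m} → (∀ e → 0# ≤ y e) →
                     ∀ e → 0# ≤ (if lookup S e then y e else 0#)
    summand-nonneg S 0≤y e with lookup S e
    ... | Subset.inside  = 0≤y e
    ... | Subset.outside = ≤-refl

  ∑-nonneg : ∀ S {y} → (∀ e → 0# ≤ y e) → 0# ≤ ∑[ S ] y
  ∑-nonneg S 0≤y = sum-nonneg (summand-nonneg S 0≤y)

  term≤∑ : ∀ S {y} → (∀ e → 0# ≤ y e) → ∀ {e} → e ∈ S → y e ≤ ∑[ S ] y
  term≤∑ S {y} 0≤y {e} e∈S =
    subst (λ b → (if b then y e else 0#) ≤ ∑[ S ] y) ([]=⇒lookup e∈S)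
      (term≤sum (summand-nonneg S 0≤y) e)

  ∑-zero : ∀ S {y} → (∀ e → e ∈ S → y e ≈ 0#) → ∑[ S ] y ≈ 0#
  ∑-zero S {y} y≈0 = sum-zero zeros
    where
    zeros : ∀ e → (if lookup S e then y e else 0#) ≈ 0#
    zeros e with lookup S e in eq
    ... | Subset.inside  = y≈0 e (lookup⇒[]= e S eq)
    ... | Subset.outside = refl

  Inside : List (Fin n) → Fin m → Set
  Inside xs e = src e ∈ˡ xs × tgt e ∈ˡ xs

  inside? : ∀ xs e → Dec (Inside xs e)
  inside? xs e = DecMembership._∈?_ _≟_ (src e) xs ×-dec DecMembership._∈?_ _≟_ (tgt e) xs

  -- The lifted multicut of the partition of V into xs and singletons.
  cluster : List (Fin n) → Point m
  cluster xs e = if does (inside? xs e) then 0# else 1#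

  cluster-inside : ∀ xs {e} → Inside xs e → cluster xs e ≈ 0#
  cluster-inside xs {e} ins rewrite dec-true (inside? xs e) ins = refl

  cluster-outside : ∀ xs {e} → ¬ Inside xs e → cluster xs e ≈ 1#
  cluster-outside xs {e} out rewrite dec-false (inside? xs e) out = refl

  cluster-nonneg : ∀ xs e → 0# ≤ cluster xs e
  cluster-nonneg xs e with does (inside? xs e)
  ... | Subset.inside  = ≤-refl
  ... | Subset.outside = 0≤1

  1-cluster-nonneg : ∀ xs e → 0# ≤ 1# - cluster xs e
  1-cluster-nonneg xs e with does (inside? xs e)
  ... | Subset.inside  = ≤-respʳ (sym (x≈0⇒1-x≈1 refl)) 0≤1
  ... | Subset.outside = ≤-reflexive (sym (x≈1⇒1-x≈0 refl))

  -- Connectedness of the subgraph of G induced by `xs`; vacuous for the empty list, whose cluster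
  -- is the all-one vector.
  Links : Subset m → List (Fin n) → Set
  Links A xs = ∀ {s t} → s ∈ˡ xs → t ∈ˡ xs → ∃ λ k → Leg A (_∈ˡ xs) k s t

  links-nodes : ∀ {A u w} (p : Walk A u w) → Links A (nodes p)
  links-nodes p s∈ t∈ with between p (nodes-self p) s∈ t∈
  ... | k , leg , _ = k , leg

  module _ {A : Subset m} {xs : List (Fin n)} where

    step-inside : ∀ {e u v} → Inside xs e → Joins e u v → u ∈ˡ xs × v ∈ˡ xs
    step-inside ins       (inj₁ (≡.refl , ≡.refl)) = ins
    step-inside (s∈ , t∈) (inj₂ (≡.refl , ≡.refl)) = t∈ , s∈

    inside-step : ∀ {e u v} → u ∈ˡ xs × v ∈ˡ xs → Joins e u v → Inside xs e
    inside-step uv∈       (inj₁ (≡.refl , ≡.refl)) = uv∈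
    inside-step (u∈ , v∈) (inj₂ (≡.refl , ≡.refl)) = v∈ , u∈

    -- Distinct ends exclude the empty walk, so each end lies on an edge of the walk.
    walk-inside : ∀ {B u w} → (∀ {e} → e ∈ B → Inside xs e) → Walk B u w → u ≢ w →
                  u ∈ˡ xs × w ∈ˡ xs
    walk-inside ins [] u≢u = contradiction ≡.refl u≢u
    walk-inside ins (step e e∈B j p) _ with step-inside {e} (ins e∈B) j
    ... | u∈ , v∈ = u∈ , last p v∈
      where
      last : ∀ {v w} → Walk _ v w → v ∈ˡ xs → w ∈ˡ xs
      last []               v∈ = v∈
      last (step f f∈B j q) _  = last q (proj₂ (step-inside {f} (ins f∈B) j))

    -- Common form of the cycle and path inequalities: if `f` is not inside, some edge of `B` is not
    -- inside either and contributes 1 to the sum.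
    cluster≤∑ : ∀ B f → ((∀ {e} → e ∈ B → Inside xs e) → Inside xs f) →
                cluster xs f ≤ ∑[ B ] (cluster xs)
    cluster≤∑ B f closed with inside? xs f
    ... | yes ins = ≤-respˡ (sym (cluster-inside xs ins)) (∑-nonneg B (cluster-nonneg xs))
    ... | no out with any? (λ e → e ∈? B ×-dec ¬? (inside? xs e))
    ...   | no none = contradiction (closed λ {e} e∈B →
              decidable-stable (inside? xs e) λ e-out → none (e , e∈B , e-out)) out
    ...   | yes (e , e∈B , e-out) =
              ≤-respˡ (trans (cluster-outside xs e-out) (sym (cluster-outside xs out))) (term≤∑ B (cluster-nonneg xs) e∈B)

    cluster∈X : Links A xs → X A (cluster xs)
    cluster∈X links = record
      { binary = binary
      ; cycles = λ C cyc e e∈C → cluster≤∑ (C Subset.- e) e λ ins →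
          let s , t , j , p = openCycle cyc e∈C
          in inside-step {e} (Product.swap (walk-inside ins p (Joins⇒≢ {e} j ∘ ≡.sym))) j
      ; paths = λ { f _ _ ((p , _) , ≡.refl) → cluster≤∑ (edges p) f λ ins →
          walk-inside ins (restrict p id) (Joins⇒≢ {f} (joins f)) }
      ; cuts = λ f _ C ((_ , sep) , _) → cuts f C sep
      }
      where
      binary : ∀ e → cluster xs e ≈ 0# ⊎ cluster xs e ≈ 1#
      binary e with does (inside? xs e)
      ... | Subset.inside  = inj₁ refl
      ... | Subset.outside = inj₂ refl
      cuts : ∀ f C → ¬ Walk (A ─ C) (src f) (tgt f) →
             1# - cluster xs f ≤ ∑[ C ] (λ e → 1# - cluster xs e)
      cuts f C sep with inside? xs f
      ... | no out = ≤-respˡ (sym (x≈1⇒1-x≈0 (cluster-outside xs out))) (∑-nonneg C (1-cluster-nonneg xs))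
      ... | yes ins-f@(s∈ , t∈) with any? (λ e → e ∈? C ×-dec inside? xs e)
      ...   | yes (e , e∈C , ins) =
        ≤-respˡ (trans (x≈0⇒1-x≈1 (cluster-inside xs ins)) (sym (x≈0⇒1-x≈1 (cluster-inside xs ins-f))))
                (term≤∑ C (1-cluster-nonneg xs) e∈C)
      -- Otherwise the walk that joins the ends of `f` within `xs` would use no edge of `C`,
      -- although `C` separates these ends.
      ...   | no none = contradiction (restrict p avoids) sep
        where
        p : Walk A (src f) (tgt f)
        p = proj₁ (proj₂ (links s∈ t∈))
        p⊆xs : All (_∈ˡ xs) (nodes p)
        p⊆xs = proj₁ (proj₂ (proj₂ (links s∈ t∈)))
        avoids : edges p ⊆ A ─ C
        avoids {g} g∈p = x∈p∧x∉q⇒x∈p─q (edges⊆ p g∈p) λ g∈C → none (g , g∈C ,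
          All.lookup p⊆xs (edge-end∈nodes p g∈p (joins g)) ,
          All.lookup p⊆xs (edge-end∈nodes p g∈p (Joins-sym {g} (joins g))))

  X⊆Ξ : ∀ {A x} → X A x → Ξ A x
  X⊆Ξ {A} = Conv-⊇ {S = X A}

  -- Edges of value 0 and connectivity in a lifted multicut.

  module _ {A : Subset m} {x : Point m} (x∈X : X A x) where
    open X x∈X

    X-nonneg : ∀ e → 0# ≤ x e
    X-nonneg e with binary e
    ... | inj₁ x≈0 = ≤-reflexive (sym x≈0)
    ... | inj₂ x≈1 = ≤-respʳ (sym x≈1) 0≤1

    X-≤1 : ∀ e → x e ≤ 1#
    X-≤1 e with binary e
    ... | inj₁ x≈0 = ≤-respˡ (sym x≈0) 0≤1
    ... | inj₂ x≈1 = ≤-reflexive x≈1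

    ≉0⇒≈1 : ∀ {e} → ¬ (x e ≈ 0#) → x e ≈ 1#
    ≉0⇒≈1 {e} ≉0 = [ (λ ≈0 → contradiction ≈0 ≉0) , id ]′ (binary e)

    private
      Zeros : Subset m
      Zeros = tabulate (λ e → does (x e ≈? 0#))

      ∈Zeros : ∀ {e} → x e ≈ 0# → e ∈ Zeros
      ∈Zeros {e} ≈0 = lookup⇒[]= e Zeros (≡.trans (lookup∘tabulate _ e) (dec-true (x e ≈? 0#) ≈0))

      ∈A─[A─Zeros]⇒≈0 : ∀ {e} → e ∈ A ─ (A ─ Zeros) → x e ≈ 0#
      ∈A─[A─Zeros]⇒≈0 {e} e∈ with x e ≈? 0#
      ... | yes ≈0 = ≈0
      ... | no ≉0 = contradiction
        (x∈p∧x∉q⇒x∈p─q (p─q⊆p A (A ─ Zeros) e∈) λ e∈Z → ≉0 (Zeros⇒≈0 e∈Z))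
        (x∈p─q⇒x∉q A (A ─ Zeros) e∈)
        where
        Zeros⇒≈0 : ∀ {e} → e ∈ Zeros → x e ≈ 0#
        Zeros⇒≈0 {e} e∈Z with x e ≈? 0# | ≡.trans (≡.sym (lookup∘tabulate (λ e → does (x e ≈? 0#)) e)) ([]=⇒lookup e∈Z)
        ... | yes ≈0 | _ = ≈0
        ... | no _   | ()

    -- Without such a walk, the edges of G with value 1 separate the ends of `f` and so contain a
    -- cut, whose inequality reads `1# ≤ 0#`.
    ¬¬-zeroWalk : ∀ {f} → f ∈ ∁ A → x f ≈ 0# →
                  ¬ ¬ (∃ λ B → B ⊆ A × (∀ {e} → e ∈ B → x e ≈ 0#) × Walk B (src f) (tgt f))
    ¬¬-zeroWalk {f} f∈ xf≈0 none =
      ¬¬-minimal (Separates A (src f) (tgt f)) {A ─ Zeros}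
        (p─q⊆p A Zeros , λ p → none (A ─ (A ─ Zeros) , p─q⊆p A (A ─ Zeros) , ∈A─[A─Zeros]⇒≈0 , p))
        λ (C , C⊆ , sep , min) → 1≰0 $
          ≤-respˡ (x≈0⇒1-x≈1 xf≈0) $
          ≤-respʳ (∑-zero C λ e e∈C → x≈1⇒1-x≈0 (≉0⇒≈1 λ ≈0 → x∈p─q⇒x∉q A Zeros (C⊆ e∈C) (∈Zeros ≈0))) $
          cuts f f∈ C (sep , min)

    x≤∑0⇒≉1 : ∀ {e} S → x e ≤ ∑[ S ] x → (∀ g → g ∈ S → x g ≈ 0#) → ¬ (x e ≈ 1#)
    x≤∑0⇒≉1 S le zeros xe≈1 = 1≰0 (≤-respˡ xe≈1 (≤-respʳ (∑-zero S zeros) le))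

    -- Loop-erased, the walk is a path of value 0. It violates the path inequality if `e` is not in
    -- `A`; otherwise it closes with `e` to a cycle that violates the cycle inequality.
    zeroWalk⇒≉1 : ∀ {B e} → B ⊆ A → (∀ {g} → g ∈ B → x g ≈ 0#) → Walk B (tgt e) (src e) →
                  ¬ (x e ≈ 1#)
    zeroWalk⇒≉1 {B} {e} B⊆A zeros p xe≈1 with e ∈? A
    ... | no e∉A = x≤∑0⇒≉1 (edges q) (paths e (x∉p⇒x∈∁p e∉A) (edges q) isPath) (λ g → zeros ∘ edges⊆ q) xe≈1
      where
      p⁻¹ : Walk B (src e) (tgt e)
      p⁻¹ = proj₁ (reverse {T = _∈ˡ nodes p} (p , nodes-self p , ≡.refl))
      q : Walk B (src e) (tgt e)
      q = proj₁ (loopErase p⁻¹)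
      isPath : IsPath A (src e) (tgt e) (edges q)
      isPath = (restrict q (B⊆A ∘ edges⊆ q) ,
                subst (Unique ∘ (src e ∷_)) (≡.sym (laterNodes-restrict q (B⊆A ∘ edges⊆ q))) (proj₁ (proj₂ (loopErase p⁻¹)))) ,
               edges-restrict q (B⊆A ∘ edges⊆ q)
    ... | yes e∈A = x≤∑0⇒≉1 (C Subset.- e) (cycles C isCycle e (x∈p∪q⁺ (inj₁ (x∈⁅x⁆ e)))) zeros-C-e xe≈1
      where
      q : Walk B (tgt e) (src e)
      q = proj₁ (loopErase p)
      unq : Unique (nodes q)
      unq = proj₁ (proj₂ (loopErase p))
      q⊆A : edges q ⊆ A
      q⊆A = B⊆A ∘ edges⊆ q
      C : Subset m
      C = ⁅ e ⁆ Subset.∪ edges q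
      -- A cycle needs three edges: a walk of one edge would be `e` itself, whose value is 1 and not
      -- 0.
      len≥2 : ∀ {u w} → Joins e w u → (q : Walk B u w) → 2 ℕ.≤ len q
      len≥2 j [] = contradiction ≡.refl (Joins⇒≢ {e} j)
      len≥2 j (step g g∈B i []) with Joins-injective {g} i (Joins-sym {e} j)
      ... | ≡.refl = contradiction (trans (sym xe≈1) (zeros g∈B)) 1≉0
      len≥2 j (step _ _ _ (step _ _ _ _)) = s≤s (s≤s z≤n)
      isCycle : IsCycle A C
      isCycle = src e , step e e∈A (joins e) (restrict q q⊆A) ,
        subst (λ l → 3 ℕ.≤ suc (List.length l)) (≡.sym (laterNodes-restrict q q⊆A)) (s≤s (len≥2 (joins e) q)) ,
        subst (Unique ∘ (tgt e ∷_)) (≡.sym (laterNodes-restrict q q⊆A)) unq ,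
        ≡.cong (⁅ e ⁆ Subset.∪_) (edges-restrict q q⊆A)
      zeros-C-e : ∀ g → g ∈ C Subset.- e → x g ≈ 0#
      zeros-C-e g g∈ with x∈p∪q⁻ ⁅ e ⁆ (edges q) (p─q⊆p C ⁅ e ⁆ g∈)
      ... | inj₁ g∈e = contradiction g∈e (x∈p─q⇒x∉q C ⁅ e ⁆ g∈)
      ... | inj₂ g∈q = zeros (edges⊆ q g∈q)

    cutVertices⇒≤ : ∀ {e f} → f ∈ ∁ A → ConnectsCutVertices A e f → x e ≤ x f
    cutVertices⇒≤ {e} {f} f∈ (cutₛ , cutₜ) with binary e | binary f
    ... | inj₁ xe≈0 | _ = ≤-respˡ (sym xe≈0) (X-nonneg f)
    ... | _ | inj₂ xf≈1 = ≤-respʳ (sym xf≈1) (X-≤1 e)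
    -- The walk of zeros exists up to double negation, which is enough for a contradiction; its
    -- section between the ends of `e` forces `x e` away from 1.
    ... | inj₂ xe≈1 | inj₁ xf≈0 = contradiction (λ (_ , B⊆A , zeros , p) → no-walk B⊆A zeros p xe≈1) (¬¬-zeroWalk f∈ xf≈0)
      where
      no-walk : ∀ {B} → B ⊆ A → (∀ {g} → g ∈ B → x g ≈ 0#) → Walk B (src f) (tgt f) → ¬ (x e ≈ 1#)
      no-walk {B} B⊆A zeros p = zeroWalk⇒≉1 B⊆A zeros
        (proj₁ (proj₁ (proj₂ (between q (nodes-self q) (on-q cutₜ) (on-q cutₛ)))))
        where
        q : Walk B (src f) (tgt f)
        q = proj₁ (loopErase p)
        nodes-q : nodes (restrict q (B⊆A ∘ edges⊆ q)) ≡ nodes q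
        nodes-q = ≡.cong (src f ∷_) (laterNodes-restrict q (B⊆A ∘ edges⊆ q))
        on-q : ∀ {v} → CutVertex A (src f) (tgt f) v → v ∈ˡ nodes q
        on-q {v} cut = subst (v ∈ˡ_) nodes-q
          (cut (restrict q (B⊆A ∘ edges⊆ q) , subst Unique (≡.sym nodes-q) (proj₁ (proj₂ (loopErase p)))))

  -- Necessity: an edge `f` between whose ends `e` joins cut-vertices prevents a facet.

  module _ {A : Subset m} (connected : Connected A) where

    origin : Point m
    origin = cluster (allFin n)

    origin≈0 : ∀ e → origin e ≈ 0#
    origin≈0 e = cluster-inside (allFin n) (∈-allFin (src e) , ∈-allFin (tgt e))

    origin∈Ξ : Ξ A origin
    origin∈Ξ = X⊆Ξ (cluster∈X λ {s} {t} _ _ →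
      len (connected s t) , connected s t , All.tabulate (λ {v} _ → ∈-allFin v) , ≡.refl)

    facet⇒¬cutVertices : ∀ {e} → DefinesFacet (Ξ A) (unit e) 1# →
                         ¬ (∃ λ f → f ∈ ∁ A × f ≢ e × ConnectsCutVertices A e f)
    facet⇒¬cutVertices {e} (_ , d , (_ , dimΞ≤) , (ps , ps∈Face , ps-indep) , _) (f , f∈ , f≢e , ccv) =
      -- With the `d + 1` points of the face these are `d + 3` points, one more than dimension
      -- `d + 1` admits. Coordinate `e` separates `y` from the face, and coordinate `f` separates
      -- the origin from all the others.
      dimΞ≤ (origin ∷ᵛ y ∷ᵛ ps)
        (λ { zero → origin∈Ξ ; (suc zero) → X⊆Ξ (cluster∈X (links-nodes q)) ; (suc (suc i)) → proj₁ (ps∈Face i) })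
        (affinelyIndependent-∷ᵛ (y ∷ᵛ ps) f (origin≈0 f)
          (λ { zero → cluster-outside (nodes q) ∉q ; (suc i) → psf≈1 i })
          (affinelyIndependent-∷ᵛ ps e (cluster-inside (nodes q) (here ≡.refl , last∈nodes q)) pse≈1 ps-indep))
      where
      q : Walk A (src e) (tgt e)
      q = proj₁ (RouteProperties.detour G′ A e f≢e ccv (connected _ _))
      ∉q : ¬ Inside (nodes q) f
      ∉q = proj₂ (RouteProperties.detour G′ A e f≢e ccv (connected _ _))
      y : Point m
      y = cluster (nodes q)
      pse≈1 : ∀ i → ps i e ≈ 1#
      pse≈1 i = trans (sym (unit-· e (ps i))) (proj₂ (ps∈Face i))
      psf≈1 : ∀ i → ps i f ≈ 1#
      psf≈1 i = antisym
        (Conv-≤1 (λ x x∈X → X-≤1 x∈X f) (proj₁ (ps∈Face i)))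
        (≤-respˡ (pse≈1 i) (Conv-mono (λ x x∈X → cutVertices⇒≤ x∈X f∈ ccv) (proj₁ (ps∈Face i))))

-- Sufficiency: a triangular system of points spans the face.

module _ {c ℓ₁ ℓ₂} (K : OrderedField c ℓ₁ ℓ₂) {n m : ℕ} (G′ : Graph n (suc m))
         {A : Subset (suc m)} (connected : Subgraph.Connected G′ A) {e : Fin (suc m)}
         (¬ccv : ¬ (∃ λ f → f ∈ ∁ A × f ≢ e × Subgraph.ConnectsCutVertices G′ A e f)) where
  open OrderedField K hiding (zero)
  open OrderedFieldProperties K
  open Polytope K
  open Graph G′
  open Subgraph G′
  open WalkProperties G′
  open LiftedMulticut K G′
  open LiftedMulticutProperties K G′
  open RouteProperties G′ A e

  private
    shortest : ∀ f → f ≢ e → ShortestRoute f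
    shortest f f≢e = shortestRoute f≢e λ (f∈ , ccv) → ¬ccv (f , f∈ , f≢e , ccv)

    -- The point of index e is the all-one vector.
    clusterNodes : Fin (suc m) → List (Fin n)
    clusterNodes f with f ≟ e
    ... | yes _   = []
    ... | no f≢e = ShortestRoute.routeNodes (shortest f f≢e)

    -- Orders the triangular system. The default 0 at `e` makes `rank≤n` and `rank≤` trivial there.
    rank : Fin (suc m) → ℕ
    rank f with f ≟ e
    ... | yes _   = 0
    ... | no f≢e = ShortestRoute.length (shortest f f≢e)

    rank≤n : ∀ f → rank f ℕ.≤ n
    rank≤n f with f ≟ e
    ... | yes _   = z≤n
    ... | no f≢e = ℕ.<⇒≤ (ShortestRoute.length< (shortest f f≢e))

    rank≤ : ∀ f {k} → Route f k → rank f ℕ.≤ k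
    rank≤ f r with f ≟ e
    ... | yes _   = z≤n
    ... | no f≢e = ShortestRoute.minimal (shortest f f≢e) r

    points : Vector (Point (suc m)) (suc m)
    points f = cluster (clusterNodes f)

    links : ∀ f → Links A (clusterNodes f)
    links f with f ≟ e
    ... | yes _   = λ ()
    ... | no f≢e = links-nodes (routeWalk (ShortestRoute.route (shortest f f≢e)))

    points∈Ξ : ∀ f → Ξ A (points f)
    points∈Ξ f = X⊆Ξ (cluster∈X (links f))

    points-e : ∀ f → points f e ≈ 1#
    points-e f = cluster-outside (clusterNodes f) (out f)
      where
      out : ∀ f → ¬ Inside (clusterNodes f) e
      out f with f ≟ e
      ... | yes _   = λ ()
      ... | no f≢e = routeWalk-avoids (ShortestRoute.route (shortest f f≢e))

    points-diagonal : ∀ f → f ≢ e → points f f ≈ 0#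
    points-diagonal f f≢e = cluster-inside (clusterNodes f) ins
      where
      ins : Inside (clusterNodes f) f
      ins with f ≟ e
      ... | yes f≡e  = contradiction f≡e f≢e
      ... | no f≢e = here ≡.refl , last∈nodes (routeWalk (ShortestRoute.route (shortest f f≢e)))

    -- The shortest route of `f` contains a strictly shorter route of `g`. For `f` equal to `e` the
    -- list is empty and contains no edge.
    inside⇒rank< : ∀ f g → g ≢ f → Inside (clusterNodes f) g → f ≢ e × rank g ℕ.< rank f
    inside⇒rank< f g g≢f ins with f ≟ e
    inside⇒rank< f g g≢f () | yes _
    inside⇒rank< f g g≢f (s∈ , t∈) | no f≢e
      with shorter-route g≢f (ShortestRoute.route (shortest f f≢e)) s∈ t∈
    ... | j , j<k , r = f≢e , ℕ.≤-<-trans (rank≤ g r) j<k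

    points-offDiagonal : ∀ f g → f ≢ g → g ≢ e → (f ≢ e × rank g ℕ.< rank f) ⊎ points f g ≈ 1#
    points-offDiagonal f g f≢g _ with inside? (clusterNodes f) g
    ... | yes ins = inj₁ (inside⇒rank< f g (f≢g ∘ ≡.sym) ins)
    ... | no out = inj₂ (cluster-outside (clusterNodes f) out)

    points-independent : AffinelyIndependent points
    points-independent =
      affinelyIndependent-triangular points e rank n rank≤n points-diagonal points-offDiagonal

  ¬cutVertices⇒facet : DefinesFacet (Ξ A) (unit e) 1#
  ¬cutVertices⇒facet =
    (λ x x∈Ξ → ≤-respˡ (sym (unit-· e x)) (Conv-≤1 (λ _ y∈X → X-≤1 y∈X e) x∈Ξ)) ,
    -- The origin and the `m + 1` points on the face show that `Ξ A` has the full dimension `m + 1`,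
    -- leaving dimension `m` for the face.
    m ,
    ((origin connected ∷ᵛ points ,
      (λ { zero → origin∈Ξ connected ; (suc i) → points∈Ξ i }) ,
      affinelyIndependent-∷ᵛ points e (origin≈0 connected e) points-e points-independent) ,
     λ ps _ → affinelyDependent ps) ,
    ((points , (λ i → points∈Ξ i , trans (unit-· e (points i)) (points-e i)) , points-independent) ,
     -- One more independent point on the face would, together with the origin, exceed the ambient
     -- dimension.
     λ ps ps∈Face indep → affinelyDependent (origin connected ∷ᵛ ps)
       (affinelyIndependent-∷ᵛ ps e (origin≈0 connected e)
         (λ i → trans (sym (unit-· e (ps i))) (proj₂ (ps∈Face i))) indep))

open OrderedField using (1#)
open Polytope using (DefinesFacet; unit)
open LiftedMulticut using (Ξ)
open Subgraph using (Connected; ConnectsCutVertices)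

theorem8 : ∀ {c ℓ₁ ℓ₂} (K : OrderedField c ℓ₁ ℓ₂) {n m : ℕ} (G′ : Graph n m)
    (E : Subset m) → Connected G′ E → (e : Fin m) →
    DefinesFacet K (Ξ K G′ E) (unit K e) (1# K) ⇔
    (¬ (∃ λ (f : Fin m) → f ∈ ∁ E × f ≢ e × ConnectsCutVertices G′ E e f))
-- The edge `e` excludes `m = 0`.
theorem8 K {m = suc _} G′ E connected e =
  mk⇔ (LiftedMulticutProperties.facet⇒¬cutVertices K G′ connected)
      (¬cutVertices⇒facet K G′ connected)
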